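{- For any abstract factorial $!_{a}$, writing $r_k=\frac{(k+1)!_{a}}{k!_{a}}$ for $k\in\mathbb{N}$, either $$\limsup_{k\to\infty}\frac{1}{r_k}=1 \qquad\text{or}\qquad \limsup_{k\to\infty}\frac{1}{r_k}\le\frac12 .$$ The upper bound $\frac12$ in the second alternative is sharp: equality $\limsup_{k\to\infty} 1/r_k=\frac12$ is attained for Bhargava's factorial of the set of primes.
   Context: $\mathbb{N}=\{0,1,2,\dots\}$ and $\mathbb{Z}^+=\{1,2,3,\dots\}$. An abstract factorial is a function $!_{a}:\mathbb{N}\to\mathbb{Z}^+$, $n\mapsto n!_{a}$, such that: (1) $0!_{a}=1$; (2) for all integers $0\le k\le n$, the generalized binomial coefficient $\binom{n}{k}_{a}:=\frac{n!_{a}}{k!_{a}\,(n-k)!_{a}}$ is a positive integer; (3) for every positive integer $n$, the ordinary factorial $n!$ divides $n!_{a}$. Bhargava's factorial of the set of primes is the abstract factorial given by $0!_{a}=1$ and, for $n\ge 1$, $n!_{a}=\prod_{p}p^{\sum_{m=0}^{\infty}\left\lfloor\frac{n-1}{p^m(p-1)}\right\rfloor}$, the product (in effect finite) being over all primes $p$. -}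

module Defs where

open import Data.Integer.Base using (+_)
open import Data.List.Base using (map; upTo)
open import Data.Nat.Base as ℕ
  using (ℕ; zero; suc; _+_; _*_; _∸_; _^_; _<_; _!; NonZero; NonTrivial; s≤s; z≤n)
open import Data.Nat.ListAction using (sum; product)
open import Data.Nat.DivMod using (_/_; m<n⇒m/n≡0)
open import Data.Nat.Divisibility using (_∣_)
open import Data.Nat.Primality using (prime?; prime⇒nonTrivial)
open import Data.Nat.Properties
open import Data.Product.Base using (_×_; Σ-syntax)
open import Data.Rational.Base as ℚ using (ℚ; 1/_)
open import Data.Rational.Properties using (normalize-pos; pos⇒nonZero)
open import Relation.Binary.PropositionalEquality using (_≡_)
open import Relation.Nullary.Decidable.Core using (yes; no)

record IsAbstractFactorial (f : ℕ → ℕ) : Set where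
  field
    positive   : ∀ n → NonZero (f n)
    f0≡1       : f 0 ≡ 1
    -- f n / (f k · f (n - k)) is an integer; it is then automatically positive,
    -- because f n is.
    binomial   : ∀ {n k} → k ℕ.≤ n → f k * f (n ∸ k) ∣ f n
    n!∣f       : ∀ n → .{{NonZero n}} → n ! ∣ f n

module _ (f : ℕ → ℕ) (isAF : IsAbstractFactorial f) where
  open IsAbstractFactorial isAF

  r : ℕ → ℚ
  r k = ℚ._/_ (+ f (suc k)) (f k) {{positive k}}

  r-nonZero : ∀ k → ℚ.NonZero (r k)
  r-nonZero k = pos⇒nonZero (r k)
    {{normalize-pos (f (suc k)) (f k) {{positive k}} {{positive (suc k)}}}}

  1/r : ℕ → ℚ
  1/r k = (1/ r k) {{r-nonZero k}}

IsSup : (ℕ → ℚ) → ℚ → Set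
IsSup u s = (∀ j → u j ℚ.≤ s) × (∀ b → (∀ j → u j ℚ.≤ b) → s ℚ.≤ b)

IsInf : (ℕ → ℚ) → ℚ → Set
IsInf u i = (∀ j → i ℚ.≤ u j) × (∀ b → (∀ j → b ℚ.≤ u j) → b ℚ.≤ i)

-- L = inf_n sup_{k ≥ n} u k.  A supremum or infimum taken in ℚ is also one in ℝ,
-- since ℚ is dense in ℝ.  Conversely, if u takes values in {1/q : q ≥ 1}, then all
-- of these real suprema and their infimum are rational, so none is lost in ℚ.
IsLimsup : (ℕ → ℚ) → ℚ → Set
IsLimsup u L =
  Σ[ s ∈ (ℕ → ℚ) ] (∀ n → IsSup (λ j → u (n + j)) (s n)) × IsInf s L

denominator : ℕ → ℕ → ℕ
denominator p m = p ^ m * (p ∸ 1)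

denominator-nonZero : ∀ p m → .{{NonTrivial p}} → NonZero (denominator p m)
denominator-nonZero (ℕ.2+ p) m = m*n≢0 (ℕ.2+ p ^ m) (suc p) {{m^n≢0 (ℕ.2+ p) m}}

floorTerm : ∀ N p → .{{NonTrivial p}} → ℕ → ℕ
floorTerm N p m = (N / denominator p m) {{denominator-nonZero p m}}

-- The terms with m > N vanish, by floorTerm-large-m.
exponent : ∀ N p → .{{NonTrivial p}} → ℕ
exponent N p = sum (map (floorTerm N p) (upTo (suc N)))

primeFactor : ℕ → ℕ → ℕ
primeFactor N p with prime? p
... | yes pr = p ^ exponent N p {{prime⇒nonTrivial pr}}
... | no  _  = 1

-- N is n - 1.  The primes p > n contribute p ^ 0, by floorTerm-large-p.
bhargava : ℕ → ℕ
bhargava zero       = 1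
bhargava n@(suc N)  = product (map (primeFactor N) (upTo (suc n)))

m<p^m : ∀ p m → .{{NonTrivial p}} → m < p ^ m
m<p^m (ℕ.2+ p) zero    = s≤s z≤n
m<p^m (ℕ.2+ p) (suc m) = begin-strict
  suc m                           ≤⟨ m<p^m (ℕ.2+ p) m ⟩
  q ^ m                           <⟨ m<m+n (q ^ m) (m^n>0 q m) ⟩
  q ^ m + q ^ m                   ≤⟨ +-monoʳ-≤ (q ^ m) (m≤m+n (q ^ m) (p * q ^ m)) ⟩
  q ^ suc m                       ∎
  where
  open ≤-Reasoning
  q = ℕ.2+ p

floorTerm-large-m : ∀ N p m → .{{_ : NonTrivial p}} → N < m → floorTerm N p m ≡ 0
floorTerm-large-m N p@(ℕ.2+ p′) m N<m = m<n⇒m/n≡0 {{denominator-nonZero p m}}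
  (<-≤-trans N<m (≤-trans (<⇒≤ (m<p^m p m)) (m≤m*n (p ^ m) (suc p′))))

floorTerm-large-p : ∀ N p m → .{{_ : NonTrivial p}} → suc N < p → floorTerm N p m ≡ 0
floorTerm-large-p N p@(ℕ.2+ p′) m (s≤s N<p-1) = m<n⇒m/n≡0 {{denominator-nonZero p m}}
  (<-≤-trans N<p-1 (m≤n*m (suc p′) (p ^ m) {{m^n≢0 p m}}))

{-# OPTIONS --safe #-}
-- Every r k is a positive integer, so each tail of 1/r attains its supremum at the
-- least r k of the tail, and the limsup is 1/M for the largest of these minima (or 0
-- when they are unbounded); hence it is 1 or at most ½.
--
-- For Bhargava's factorial, passing from k! to (k+1)! raises the exponent of p by the
-- number of m with p^m (p − 1) ∣ k.  For p = 2, m = 0 this divisor is 1, so r k is even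
-- for k ≥ 1; all the others are even, so r k = 2 whenever k is odd.
module Submission where

open import Defs
open import Algebra.Properties.CommutativeSemigroup as CommutativeSemigroupProperties
  using ()
open import Axiom.ExcludedMiddle using (ExcludedMiddle)
open import Data.Integer.Base as ℤ using (+[1+_]; -[1+_])
import Data.Integer.Properties as ℤ
open import Data.List.Base using (List; []; _∷_; _++_; [_]; map; upTo; applyUpTo)
open import Data.List.Properties using (map-++; map-applyUpTo; map-cong; map-upTo; upTo-∷ʳ)
open import Data.List.Relation.Unary.All using (All; []; _∷_)
open import Data.Nat.Base hiding (_≤_; _/_)
open import Data.Nat.Base as ℕ using (ℕ)
open import Data.Nat.Coprimality using (1-coprimeTo) renaming (sym to coprime-sym)
open import Data.Nat.Divisibility
open import Data.Nat.DivMod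
open import Data.Nat.ListAction using (sum; product)
open import Data.Nat.ListAction.Properties using (sum-++; product-++)
open import Data.Nat.Primality
open import Data.Nat.Primality.Factorisation using (factorise; module PrimeFactorisation)
open import Data.Nat.Properties
open import Data.Product.Base using (_×_; Σ-syntax; ∃-syntax; _,_; proj₁; proj₂)
open import Data.Rational.Base as ℚ using (ℚ; mkℚ; _≤_; *≤*; 0ℚ; 1ℚ; ½; 1/_)
open import Data.Rational.Unnormalised.Base using (mkℚᵘ; *≡*)
import Data.Rational.Properties as ℚ
open import Data.Sum.Base using (_⊎_; inj₁; inj₂)
open import Function.Base using (_∘_)
open import Level using (0ℓ)
open import Relation.Binary.PropositionalEquality hiding ([_])
open import Relation.Nullary.Decidable using (Dec; yes; no)
open import Relation.Nullary.Negation using (¬_; contradiction)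

open CommutativeSemigroupProperties +-commutativeSemigroup
  using () renaming (interchange to +-interchange)
open CommutativeSemigroupProperties *-commutativeSemigroup
  using () renaming (interchange to *-interchange)

private
  variable
    u : ℕ → ℚ
    s : ℚ
    P Q : Set

-- Unit fractions and limits superior

-- The index is the denominator minus one, so every index is valid; `1/1+ 0` computes to `1ℚ` and
-- `1/1+ 1` to `½`.
1/1+ : ℕ → ℚ
1/1+ q = mkℚ (ℤ.+ 1) q (1-coprimeTo (suc q))

1/1+-anti-≤ : ∀ {p q} → p ℕ.≤ q → 1/1+ q ≤ 1/1+ p
1/1+-anti-≤ {p} {q} p≤q = *≤* (subst₂ ℤ._≤_
  (sym (ℤ.*-identityˡ (ℤ.+ suc p))) (sym (ℤ.*-identityˡ (ℤ.+ suc q)))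
  (ℤ.+≤+ (s≤s p≤q)))

0≤1/1+ : ∀ q → 0ℚ ≤ 1/1+ q
0≤1/1+ q = *≤* (ℤ.+≤+ z≤n)

-- The Archimedean property: a positive `b` with denominator `suc d` is at least `1/1+ d`, hence
-- exceeds `1/1+ p` for every `p > d`. Only cofinally many `p` are supposed, since tail minima may
-- skip values.
≤-allUnitFractions⇒≤0 : ∀ b → (∀ q → ∃[ p ] (q ℕ.≤ p × b ≤ 1/1+ p)) → b ≤ 0ℚ
≤-allUnitFractions⇒≤0 (mkℚ (ℤ.+ zero) d _)  small = *≤* (ℤ.+≤+ z≤n)
≤-allUnitFractions⇒≤0 (mkℚ -[1+ _ ] d _)  small = *≤* ℤ.-≤+
≤-allUnitFractions⇒≤0 (mkℚ +[1+ a ] d _)  small with small (suc d)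
... | p , 1+d≤p , *≤* b≤ = contradiction 1+p≤1+d (<⇒≱ (s≤s 1+d≤p))
  where
  1+p≤1+d : suc p ℕ.≤ suc d
  1+p≤1+d = ≤-trans (m≤n*m (suc p) (suc a))
    (ℤ.drop‿+≤+ (subst (ℤ.+ (suc a * suc p) ℤ.≤_) (ℤ.*-identityˡ (ℤ.+ suc d)) b≤))

1/[a/b]≡1/1+ : ∀ a b q .{{_ : NonZero b}} .{{_ : ℚ.NonZero (ℤ.+ a ℚ./ b)}} →
               a ≡ suc q * b → 1/ (ℤ.+ a ℚ./ b) ≡ 1/1+ q
1/[a/b]≡1/1+ a (suc b) q a≡ = 1/-cong a/b≡
  where
  c = coprime-sym (1-coprimeTo (suc q))

  a/b≡ : ℤ.+ a ℚ./ suc b ≡ mkℚ +[1+ q ] 0 c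
  a/b≡ = trans
    (ℚ.fromℚᵘ-cong {mkℚᵘ (ℤ.+ a) b} {mkℚᵘ +[1+ q ] 0}
      (*≡* (trans (ℤ.*-identityʳ (ℤ.+ a)) (trans (cong ℤ.+_ a≡) (ℤ.pos-* (suc q) (suc b))))))
    (ℚ.normalize-coprime c)

  -- The reciprocal depends on a proof that its argument is nonzero, so the argument is generalised
  -- to a variable before the equation is matched.
  1/-cong : ∀ {x} .{{_ : ℚ.NonZero x}} → x ≡ mkℚ +[1+ q ] 0 c → 1/ x ≡ 1/1+ q
  1/-cong refl = refl

max⇒IsSup : ∀ j → u j ≡ s → (∀ i → u i ≤ s) → IsSup u s
max⇒IsSup j refl u≤s = u≤s , λ b u≤b → u≤b j

min⇒IsInf : ∀ j → u j ≡ s → (∀ i → s ≤ u i) → IsInf u s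
min⇒IsInf j refl s≤u = s≤u , λ b b≤u → b≤u j

-- The limit superior of a sequence of unit fractions

module _ (u : ℕ → ℚ) (ρ : ℕ → ℕ) (u≡ : ∀ k → u k ≡ 1/1+ (ρ k)) where

  -- `1/1+` reverses the order, so a minimum of `ρ` attained on the tail is a maximum of `u` there.
  tailSup : ∀ n j m → ρ (n + j) ≡ m → (∀ i → m ℕ.≤ ρ (n + i)) →
            IsSup (λ i → u (n + i)) (1/1+ m)
  tailSup n j m ρ≡m m≤ρ = max⇒IsSup j (trans (u≡ (n + j)) (cong 1/1+ ρ≡m))
    λ i → subst (_≤ 1/1+ m) (sym (u≡ (n + i))) (1/1+-anti-≤ (m≤ρ i))

  module _ (em : ExcludedMiddle 0ℓ) where

    -- Excluded middle either certifies `j` as a minimiser or supplies a smaller value; the bound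
    -- `b` then drops, which makes the descent structural.
    leastValue : ∀ (σ : ℕ → ℕ) b j → σ j ℕ.≤ b → ∃[ i ] (∀ k → σ i ℕ.≤ σ k)
    leastValue σ b j σj≤b with em {∃[ k ] σ k < σ j}
    leastValue σ b       j σj≤b | no ∄smaller = j , λ k → ≮⇒≥ λ σk<σj → ∄smaller (k , σk<σj)
    leastValue σ zero    j σj≤b | yes (k , σk<σj) = contradiction σj≤b (<⇒≱ (≤-<-trans z≤n σk<σj))
    leastValue σ (suc b) j σj≤b | yes (k , σk<σj) = leastValue σ b k (s≤s⁻¹ (≤-trans σk<σj σj≤b))

    argmin : ∀ n → ∃[ i ] (∀ k → ρ (n + i) ℕ.≤ ρ (n + k))
    argmin n = leastValue (λ j → ρ (n + j)) _ 0 ≤-refl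

    tailMin : ℕ → ℕ
    tailMin n = ρ (n + proj₁ (argmin n))

    tailMin-isSup : ∀ n → IsSup (λ j → u (n + j)) (1/1+ (tailMin n))
    tailMin-isSup n = tailSup n (proj₁ (argmin n)) _ refl (proj₂ (argmin n))

    -- Without a largest tail minimum each one can be exceeded, and `q` such improvements reach at
    -- least `q`.
    unbounded : ¬ (∃[ n ] (∀ k → tailMin k ℕ.≤ tailMin n)) → ∀ q → ∃[ n ] q ℕ.≤ tailMin n
    unbounded ∄max zero    = 0 , z≤n
    unbounded ∄max (suc q) with unbounded ∄max q
    ... | n , q≤ with em {∃[ k ] tailMin n < tailMin k}
    ...   | yes (k , n<k) = k , ≤-<-trans q≤ n<k
    ...   | no  ∄larger   = contradiction (n , λ k → ≮⇒≥ λ n<k → ∄larger (k , n<k)) ∄max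

    limsup-dichotomy : IsLimsup u 1ℚ ⊎ (∃[ L ] (IsLimsup u L × L ≤ ½))
    limsup-dichotomy with em {∃[ n ] (∀ k → tailMin k ℕ.≤ tailMin n)}
    ... | no ∄max = inj₂ (0ℚ , (1/1+ ∘ tailMin , tailMin-isSup , 0≤1/1+ ∘ tailMin , greatest) , 0≤1/1+ 1)
      where
      greatest : ∀ b → (∀ n → b ≤ 1/1+ (tailMin n)) → b ≤ 0ℚ
      greatest b b≤ = ≤-allUnitFractions⇒≤0 b λ q →
        let n , q≤ = unbounded ∄max q in tailMin n , q≤ , b≤ n
    ... | yes (n , isMax) = byMaximum (tailMin n) refl
      where
      isLimsup : IsLimsup u (1/1+ (tailMin n))
      isLimsup = 1/1+ ∘ tailMin , tailMin-isSup , min⇒IsInf n refl (1/1+-anti-≤ ∘ isMax)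

      -- Denominators are offset by one: maximum `0` means limsup 1, and any larger maximum means at
      -- most `½`.
      byMaximum : ∀ m → m ≡ tailMin n → IsLimsup u 1ℚ ⊎ (∃[ L ] (IsLimsup u L × L ≤ ½))
      byMaximum zero    m≡ = inj₁ (subst (IsLimsup u ∘ 1/1+) (sym m≡) isLimsup)
      byMaximum (suc m) m≡ = inj₂ (1/1+ (tailMin n) , isLimsup ,
        1/1+-anti-≤ (subst (1 ℕ.≤_) m≡ (s≤s z≤n)))

-- Integrality of the ratios of an abstract factorial

module _ (f : ℕ → ℕ) (isAF : IsAbstractFactorial f) where
  open IsAbstractFactorial isAF

  1/r≡1/1+ : ∀ k q → f (suc k) ≡ suc q * f k → 1/r f isAF k ≡ 1/1+ q
  1/r≡1/1+ k q = 1/[a/b]≡1/1+ (f (suc k)) (f k) q {{positive k}} {{r-nonZero f isAF k}}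

  -- The binomial coefficient of `suc k` over `k` has denominator `f k * f 1`, so `f k` divides
  -- `f (suc k)`; positivity of `f (suc k)` excludes the quotient 0.
  r-integral : ∀ k → ∃[ q ] f (suc k) ≡ suc q * f k
  r-integral k with m*n∣⇒m∣ (f k) (f (suc k ∸ k)) (binomial (n≤1+n k))
  ... | divides zero    eq = contradiction eq (≢-nonZero⁻¹ (f (suc k)) {{positive (suc k)}})
  ... | divides (suc q) eq = q , eq

-- Finite sums and products over primes

Exponents : Set
Exponents = ∀ p → .{{NonTrivial p}} → ℕ

-- `primeFactor` with the exponents made a parameter, so that sums and comparisons of exponents turn
-- into products and divisibilities.
primePower : Exponents → ℕ → ℕ
primePower e p with prime? p
... | yes pr = p ^ e p {{prime⇒nonTrivial pr}}
... | no  _  = 1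

-- The product is over the primes p < n.
primeProduct : Exponents → ℕ → ℕ
primeProduct e n = product (map (primePower e) (upTo n))

∑ : (ℕ → ℕ) → ℕ → ℕ
∑ g n = sum (map g (upTo n))

map-upTo-last : ∀ (g : ℕ → ℕ) n → map g (upTo (suc n)) ≡ map g (upTo n) ++ [ g n ]
map-upTo-last g n = trans (cong (map g) (sym (upTo-∷ʳ n))) (map-++ g (upTo n) [ n ])

∑-last : ∀ g n → ∑ g (suc n) ≡ ∑ g n + g n
∑-last g n = begin
  ∑ g (suc n)               ≡⟨ cong sum (map-upTo-last g n) ⟩
  sum (map g (upTo n) ++ _) ≡⟨ sum-++ (map g (upTo n)) [ g n ] ⟩
  ∑ g n + (g n + 0)         ≡⟨ cong (∑ g n +_) (+-identityʳ (g n)) ⟩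
  ∑ g n + g n               ∎
  where open ≡-Reasoning

∑-first : ∀ g n → ∑ g (suc n) ≡ g 0 + ∑ (g ∘ suc) n
∑-first g n = cong (λ xs → g 0 + sum xs) (begin
  map g (applyUpTo suc n) ≡⟨ map-applyUpTo suc g n ⟩
  applyUpTo (g ∘ suc) n   ≡⟨ map-upTo (g ∘ suc) n ⟨
  map (g ∘ suc) (upTo n)                 ∎)
  where open ≡-Reasoning

∑-mono-≤ : ∀ {g h} n → (∀ i → g i ℕ.≤ h i) → ∑ g n ℕ.≤ ∑ h n
∑-mono-≤         zero    g≤h = z≤n
∑-mono-≤ {g} {h} (suc n) g≤h = begin
  ∑ g (suc n)  ≡⟨ ∑-last g n ⟩
  ∑ g n + g n  ≤⟨ +-mono-≤ (∑-mono-≤ n g≤h) (g≤h n) ⟩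
  ∑ h n + h n  ≡⟨ ∑-last h n ⟨
  ∑ h (suc n)  ∎
  where open ≤-Reasoning

∑-cong : ∀ {g h} n → (∀ i → g i ≡ h i) → ∑ g n ≡ ∑ h n
∑-cong n g≗h = cong sum (map-cong g≗h (upTo n))

∑-+ : ∀ g h n → ∑ (λ i → g i + h i) n ≡ ∑ g n + ∑ h n
∑-+ g h zero    = refl
∑-+ g h (suc n) = begin
  ∑ (λ i → g i + h i) (suc n)         ≡⟨ ∑-last (λ i → g i + h i) n ⟩
  ∑ (λ i → g i + h i) n + (g n + h n) ≡⟨ cong (_+ (g n + h n)) (∑-+ g h n) ⟩
  (∑ g n + ∑ h n) + (g n + h n)       ≡⟨ +-interchange (∑ g n) (∑ h n) (g n) (h n) ⟩
  (∑ g n + g n) + (∑ h n + h n)       ≡⟨ cong₂ _+_ (∑-last g n) (∑-last h n) ⟨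
  ∑ g (suc n) + ∑ h (suc n)           ∎
  where open ≡-Reasoning

∑-zero : ∀ {g} n → (∀ i → g i ≡ 0) → ∑ g n ≡ 0
∑-zero {g} zero    g≡0 = refl
∑-zero {g} (suc n) g≡0 = trans (∑-last g n) (cong₂ _+_ (∑-zero n g≡0) (g≡0 n))

-- With `primeProduct-vanishing`, this brings sums and products with different cut-offs to a common
-- range.
∑-vanishing : ∀ g n k → (∀ i → n ℕ.≤ i → g i ≡ 0) → ∑ g (k + n) ≡ ∑ g n
∑-vanishing g n zero    g≡0 = refl
∑-vanishing g n (suc k) g≡0 = begin
  ∑ g (suc k + n)         ≡⟨ ∑-last g (k + n) ⟩
  ∑ g (k + n) + g (k + n) ≡⟨ cong (∑ g (k + n) +_) (g≡0 (k + n) (m≤n+m n k)) ⟩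
  ∑ g (k + n) + 0         ≡⟨ +-identityʳ _ ⟩
  ∑ g (k + n)             ≡⟨ ∑-vanishing g n k g≡0 ⟩
  ∑ g n                   ∎
  where open ≡-Reasoning

primeProduct-last : ∀ e n → primeProduct e (suc n) ≡ primeProduct e n * primePower e n
primeProduct-last e n = begin
  primeProduct e (suc n)                     ≡⟨ cong product (map-upTo-last (primePower e) n) ⟩
  product (map (primePower e) (upTo n) ++ _) ≡⟨ product-++ (map (primePower e) (upTo n)) [ primePower e n ] ⟩
  primeProduct e n * (primePower e n * 1)    ≡⟨ cong (primeProduct e n *_) (*-identityʳ _) ⟩
  primeProduct e n * primePower e n          ∎
  where open ≡-Reasoning

_⊕_ : Exponents → Exponents → Exponents
(e₁ ⊕ e₂) p = e₁ p + e₂ p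

_≤ₑ_ : Exponents → Exponents → Set
e₁ ≤ₑ e₂ = ∀ p .{{_ : NonTrivial p}} → e₁ p ℕ.≤ e₂ p

primePower-⊕ : ∀ e₁ e₂ p → primePower (e₁ ⊕ e₂) p ≡ primePower e₁ p * primePower e₂ p
primePower-⊕ e₁ e₂ p with prime? p
... | yes pr = ^-distribˡ-+-* p (e₁ p {{prime⇒nonTrivial pr}}) (e₂ p {{prime⇒nonTrivial pr}})
... | no  _  = refl

primePower-mono-∣ : ∀ {e₁ e₂} → e₁ ≤ₑ e₂ → ∀ p → primePower e₁ p ∣ primePower e₂ p
primePower-mono-∣ {e₁} {e₂} e₁≤e₂ p with prime? p
... | yes pr = divides (p ^ (x₂ ∸ x₁)) (begin
  p ^ x₂                  ≡⟨ cong (p ^_) (m∸n+n≡m (e₁≤e₂ p {{prime⇒nonTrivial pr}})) ⟨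
  p ^ (x₂ ∸ x₁ + x₁)      ≡⟨ ^-distribˡ-+-* p (x₂ ∸ x₁) x₁ ⟩
  p ^ (x₂ ∸ x₁) * p ^ x₁  ∎)
  where
  open ≡-Reasoning
  x₁ = e₁ p {{prime⇒nonTrivial pr}}
  x₂ = e₂ p {{prime⇒nonTrivial pr}}
... | no  _  = ∣-refl

primePower-cong : ∀ {e₁ e₂} p → (∀ .{{_ : NonTrivial p}} → Prime p → e₁ p ≡ e₂ p) →
                  primePower e₁ p ≡ primePower e₂ p
primePower-cong p e₁≡e₂ with prime? p
... | yes pr = cong (p ^_) (e₁≡e₂ {{prime⇒nonTrivial pr}} pr)
... | no  _  = refl

primePower≡1 : ∀ {e} p → (∀ .{{_ : NonTrivial p}} → e p ≡ 0) → primePower e p ≡ 1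
primePower≡1 p e≡0 with prime? p
... | yes pr = cong (p ^_) (e≡0 {{prime⇒nonTrivial pr}})
... | no  _  = refl

primePower-nonZero : ∀ e p → NonZero (primePower e p)
primePower-nonZero e p with prime? p
... | yes pr = m^n≢0 p (e p {{prime⇒nonTrivial pr}}) {{prime⇒nonZero pr}}
... | no  _  = _

primeProduct-nonZero : ∀ e n → NonZero (primeProduct e n)
primeProduct-nonZero e zero    = _
primeProduct-nonZero e (suc n) = subst NonZero (sym (primeProduct-last e n))
  (m*n≢0 _ _ {{primeProduct-nonZero e n}} {{primePower-nonZero e n}})

primeProduct-⊕ : ∀ e₁ e₂ n → primeProduct (e₁ ⊕ e₂) n ≡ primeProduct e₁ n * primeProduct e₂ n
primeProduct-⊕ e₁ e₂ zero    = refl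
primeProduct-⊕ e₁ e₂ (suc n) = begin
  primeProduct (e₁ ⊕ e₂) (suc n)
    ≡⟨ primeProduct-last (e₁ ⊕ e₂) n ⟩
  primeProduct (e₁ ⊕ e₂) n * primePower (e₁ ⊕ e₂) n
    ≡⟨ cong₂ _*_ (primeProduct-⊕ e₁ e₂ n) (primePower-⊕ e₁ e₂ n) ⟩
  (primeProduct e₁ n * primeProduct e₂ n) * (primePower e₁ n * primePower e₂ n)
    ≡⟨ *-interchange (primeProduct e₁ n) (primeProduct e₂ n) (primePower e₁ n) (primePower e₂ n) ⟩
  (primeProduct e₁ n * primePower e₁ n) * (primeProduct e₂ n * primePower e₂ n)
    ≡⟨ cong₂ _*_ (primeProduct-last e₁ n) (primeProduct-last e₂ n) ⟨
  primeProduct e₁ (suc n) * primeProduct e₂ (suc n) ∎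
  where open ≡-Reasoning

primeProduct-mono-∣ : ∀ {e₁ e₂} n → e₁ ≤ₑ e₂ → primeProduct e₁ n ∣ primeProduct e₂ n
primeProduct-mono-∣           zero    e₁≤e₂ = ∣-refl
primeProduct-mono-∣ {e₁} {e₂} (suc n) e₁≤e₂ =
  subst₂ _∣_ (sym (primeProduct-last e₁ n)) (sym (primeProduct-last e₂ n))
    (*-pres-∣ (primeProduct-mono-∣ {e₁} {e₂} n e₁≤e₂) (primePower-mono-∣ {e₁} {e₂} e₁≤e₂ n))

-- Agreement is asked at primes only, because the comparison `jump≡δ2` relies on `p ∸ 1` being even
-- for odd primes.
primeProduct-cong : ∀ {e₁ e₂} n → (∀ p .{{_ : NonTrivial p}} → Prime p → e₁ p ≡ e₂ p) →
                    primeProduct e₁ n ≡ primeProduct e₂ n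
primeProduct-cong {e₁} {e₂} n e₁≡e₂ =
  cong product (map-cong (λ p → primePower-cong {e₁} {e₂} p (e₁≡e₂ p)) (upTo n))

primeProduct-vanishing : ∀ {e} n k → (∀ p .{{_ : NonTrivial p}} → n ℕ.≤ p → e p ≡ 0) →
                         primeProduct e (k + n) ≡ primeProduct e n
primeProduct-vanishing {e} n zero    e≡0 = refl
primeProduct-vanishing {e} n (suc k) e≡0 = begin
  primeProduct e (suc k + n)                    ≡⟨ primeProduct-last e (k + n) ⟩
  primeProduct e (k + n) * primePower e (k + n) ≡⟨ cong (primeProduct e (k + n) *_)
                                                     (primePower≡1 {e} (k + n) (e≡0 (k + n) (m≤n+m n k))) ⟩
  primeProduct e (k + n) * 1                    ≡⟨ *-identityʳ _ ⟩
  primeProduct e (k + n)                        ≡⟨ primeProduct-vanishing {e} n k e≡0 ⟩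
  primeProduct e n                              ∎
  where open ≡-Reasoning

-- Indicators and the exponents of a single prime

𝟙 : Dec P → ℕ
𝟙 (yes _) = 1
𝟙 (no  _) = 0

𝟙-mono-≤ : (dP : Dec P) (dQ : Dec Q) → (P → Q) → 𝟙 dP ℕ.≤ 𝟙 dQ
𝟙-mono-≤ (no  _) dQ      P⇒Q = z≤n
𝟙-mono-≤ (yes _) (yes _) P⇒Q = ≤-refl
𝟙-mono-≤ (yes p) (no ¬q) P⇒Q = contradiction (P⇒Q p) ¬q

𝟙≡1 : (dP : Dec P) → P → 𝟙 dP ≡ 1
𝟙≡1 (yes _) p = refl
𝟙≡1 (no ¬p) p = contradiction p ¬p

𝟙≡0 : (dP : Dec P) → ¬ P → 𝟙 dP ≡ 0
𝟙≡0 (yes p) ¬p = contradiction p ¬p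
𝟙≡0 (no  _) ¬p = refl

-- For a prime `q`, the exponents in the factorisation of `q` itself.
δ : ℕ → Exponents
δ q p = 𝟙 (p ≟ q)

primeProduct-δ : ∀ {q n} → Prime q → q < n → primeProduct (δ q) n ≡ q
primeProduct-δ {q} {n} pr q<n = begin
  primeProduct (δ q) n                     ≡⟨ cong (primeProduct (δ q)) (m∸n+n≡m q<n) ⟨
  primeProduct (δ q) (n ∸ suc q + suc q)   ≡⟨ primeProduct-vanishing {δ q} (suc q) (n ∸ suc q)
                                                (λ p q<p → 𝟙≡0 (p ≟ q) (>⇒≢ q<p)) ⟩
  primeProduct (δ q) (suc q)               ≡⟨ primeProduct-last (δ q) q ⟩
  primeProduct (δ q) q * primePower (δ q) q ≡⟨ cong₂ _*_ (below q ≤-refl) atPrime ⟩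
  1 * q                                    ≡⟨ *-identityˡ q ⟩
  q                                        ∎
  where
  open ≡-Reasoning

  atPrime : primePower (δ q) q ≡ q
  atPrime with prime? q
  ... | yes _ = trans (cong (q ^_) (𝟙≡1 (q ≟ q) refl)) (*-identityʳ q)
  ... | no ¬pr = contradiction pr ¬pr

  below : ∀ k → k ℕ.≤ q → primeProduct (δ q) k ≡ 1
  below zero    k≤q = refl
  below (suc k) k<q = trans (primeProduct-last (δ q) k)
    (cong₂ _*_ (below k (<⇒≤ k<q)) (primePower≡1 {δ q} k (𝟙≡0 (k ≟ q) (<⇒≢ k<q))))

-- Legendre's formula

-- One half of the Galois connection between multiplication and floor division by `d`.
*≤⇒≤/ : ∀ {c n} d .{{_ : NonZero d}} → c * d ℕ.≤ n → c ℕ.≤ n / d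
*≤⇒≤/ {c} d c*d≤n = subst (ℕ._≤ _) (m*n/n≡m c d) (/-monoˡ-≤ d c*d≤n)

+-/-≤ : ∀ m n d .{{_ : NonZero d}} → m / d + n / d ℕ.≤ (m + n) / d
+-/-≤ m n d = *≤⇒≤/ d (begin
  (m / d + n / d) * d       ≡⟨ *-distribʳ-+ d (m / d) (n / d) ⟩
  m / d * d + n / d * d     ≤⟨ +-mono-≤ (m/n*n≤m m d) (m/n*n≤m n d) ⟩
  m + n                     ∎)
  where open ≤-Reasoning

-- This increment drives both Legendre's count of multiples and the growth of Bhargava's exponents.
suc-/ : ∀ n d .{{_ : NonZero d}} → suc n / d ≡ n / d + 𝟙 (d ∣? suc n)
suc-/ n d with d ∣? suc n
... | no d∤1+n = trans (≤-antisym
  -- Non-divisibility makes `(suc n / d) * d` strictly less than `suc n`, so this multiple of `d`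
  -- already fits into `n`.
  (*≤⇒≤/ d (s≤s⁻¹ (≤∧≢⇒< (m/n*n≤m (suc n) d) λ eq → d∤1+n (divides (suc n / d) (sym eq)))))
  (/-monoˡ-≤ d (n≤1+n n)))
  (sym (+-identityʳ (n / d)))
... | yes (divides (suc t) 1+n≡) = begin-equality
  suc n / d       ≡⟨ /-congˡ 1+n≡ ⟩
  suc t * d / d   ≡⟨ m*n/n≡m (suc t) d ⟩
  -- From `1 ≤ d` follows `t * d ≤ n`, and `n < suc t * d` gives the opposite bound on the quotient.
  suc t           ≡⟨ cong suc (≤-antisym
                       (*≤⇒≤/ d (s≤s⁻¹ (≤-trans (+-monoˡ-≤ (t * d) (>-nonZero⁻¹ d)) (≤-reflexive (sym 1+n≡)))))
                       (s≤s⁻¹ (m<n*o⇒m/o<n (≤-reflexive 1+n≡)))) ⟩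
  suc (n / d)     ≡⟨ +-comm 1 (n / d) ⟩
  n / d + 1       ∎
  where open ≤-Reasoning

-- The p-adic valuation of n, provided 0 < n ≤ M.
valuation : ℕ → ℕ → Exponents
valuation M n p = ∑ (λ m → 𝟙 (p ^ suc m ∣? n)) M

-- Multiplication by `q` shifts the indicators up one place and adds a first term 1. The last
-- indicator for `n`, which has no place left to move to, is zero because its power of `q` exceeds
-- `n`.
valuation-prime-* : ∀ {M n} q .{{_ : NonZero n}} → n ℕ.≤ M → .{{_ : NonTrivial q}} →
                    suc (valuation M n q) ℕ.≤ valuation M (q * n) q
valuation-prime-* {zero}  {n} q n≤M = contradiction (n≤0⇒n≡0 n≤M) (≢-nonZero⁻¹ n)
valuation-prime-* {suc M} {n} q n≤M = begin
  suc (∑ a (suc M))   ≡⟨ cong suc (∑-last a M) ⟩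
  suc (∑ a M + a M)   ≡⟨ cong (λ x → suc (∑ a M + x)) (𝟙≡0 (q ^ suc M ∣? n) q^1+M∤n) ⟩
  suc (∑ a M + 0)     ≡⟨ cong suc (+-identityʳ _) ⟩
  1 + ∑ a M           ≤⟨ +-mono-≤ (≤-reflexive (sym (𝟙≡1 (q ^ 1 ∣? q * n) q^1∣q*n)))
                           (∑-mono-≤ M λ m →
                             𝟙-mono-≤ (q ^ suc m ∣? n) (q ^ suc (suc m) ∣? q * n) (*-monoʳ-∣ q)) ⟩
  b 0 + ∑ (b ∘ suc) M ≡⟨ ∑-first b M ⟨
  ∑ b (suc M)         ∎
  where
  open ≤-Reasoning
  a = λ m → 𝟙 (q ^ suc m ∣? n)
  b = λ m → 𝟙 (q ^ suc m ∣? q * n)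

  q^1+M∤n : ¬ q ^ suc M ∣ n
  q^1+M∤n = >⇒∤ (≤-<-trans n≤M (m<p^m q (suc M)))

  q^1∣q*n : q ^ 1 ∣ q * n
  q^1∣q*n = subst (_∣ q * n) (sym (^-identityʳ q)) (m∣m*n n)

-- Induction over the prime factorisation: each further prime `q` contributes the exponents `δ q`,
-- and the valuations grow by at least as much.
n∣primeProduct-valuation : ∀ {M K} n .{{_ : NonZero n}} → n ℕ.≤ M → n < K →
                           n ∣ primeProduct (valuation M n) K
n∣primeProduct-valuation {M} {K} n n≤M n<K =
  subst (λ n → n ∣ primeProduct (valuation M n) K) (sym isFactorisation)
    (overFactors factors factorsPrime (subst (ℕ._≤ M) isFactorisation n≤M)
      (subst (_< K) isFactorisation n<K))
  where
  open PrimeFactorisation (factorise n)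

  overFactors : ∀ ps → All Prime ps → product ps ℕ.≤ M → product ps < K →
                product ps ∣ primeProduct (valuation M (product ps)) K
  overFactors []       []         ps≤M ps<K = 1∣ _
  overFactors (q ∷ ps) (pr ∷ prs) ps≤M ps<K = begin
    q * n′                                            ∣⟨ *-monoʳ-∣ q (overFactors ps prs n′≤M n′<K) ⟩
    q * primeProduct v K                              ≡⟨ cong (_* primeProduct v K) (primeProduct-δ pr q<K) ⟨
    primeProduct (δ q) K * primeProduct v K           ≡⟨ primeProduct-⊕ (δ q) v K ⟨
    primeProduct (δ q ⊕ v) K                          ∣⟨ primeProduct-mono-∣ {δ q ⊕ v} {valuation M (q * n′)} K exponent-≤ ⟩
    primeProduct (valuation M (q * n′)) K             ∎
    where
    open ∣-Reasoning
    n′ = product ps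
    v  = valuation M n′
    instance
      q≢0 : NonZero q
      q≢0 = prime⇒nonZero pr
      n′≢0 : NonZero n′
      n′≢0 = productOfPrimes≢0 prs
    n′≤M = ≤-trans (m≤n*m n′ q) ps≤M
    n′<K = ≤-<-trans (m≤n*m n′ q) ps<K
    q<K  = ≤-<-trans (m≤m*n q n′) ps<K

    exponent-≤ : (δ q ⊕ v) ≤ₑ valuation M (q * n′)
    exponent-≤ p with p ≟ q
    ... | yes refl = valuation-prime-* q n′≤M
    ... | no  _    = ∑-mono-≤ M λ m →
      𝟙-mono-≤ (p ^ suc m ∣? n′) (p ^ suc m ∣? q * n′) (∣n⇒∣m*n q)

-- The recursion follows that of `n !`, so each new factor `suc n` adds exactly its valuation to the
-- exponents.
multiples : ℕ → ℕ → ℕ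
multiples zero    d = 0
multiples (suc n) d = multiples n d + 𝟙 (d ∣? suc n)

multiples≡/ : ∀ n d .{{_ : NonZero d}} → multiples n d ≡ n / d
multiples≡/ zero    d = sym (0/n≡0 d)
multiples≡/ (suc n) d = trans (cong (_+ 𝟙 (d ∣? suc n)) (multiples≡/ n d)) (sym (suc-/ n d))

multiples-*-≤ : ∀ n d .{{_ : NonZero d}} → multiples n d * d ℕ.≤ n
multiples-*-≤ n d = subst (λ c → c * d ℕ.≤ n) (sym (multiples≡/ n d)) (m/n*n≤m n d)

-- Legendre's exponent of p in n!, provided n ≤ M.
legendre : ℕ → ℕ → Exponents
legendre M n p = ∑ (λ m → multiples n (p ^ suc m)) M

n!∣primeProduct-legendre : ∀ {M K} n → n ℕ.≤ M → n < K → n ! ∣ primeProduct (legendre M n) K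
n!∣primeProduct-legendre zero    n≤M n<K = 1∣ _
n!∣primeProduct-legendre {M} {K} (suc n) n<M 1+n<K = begin
  suc n * n !                                   ∣⟨ *-pres-∣ (n∣primeProduct-valuation (suc n) n<M 1+n<K)
                                                     (n!∣primeProduct-legendre n (<⇒≤ n<M) (<⇒≤ 1+n<K)) ⟩
  primeProduct v K * primeProduct l K           ≡⟨ *-comm (primeProduct v K) (primeProduct l K) ⟩
  primeProduct l K * primeProduct v K           ≡⟨ primeProduct-⊕ l v K ⟨
  primeProduct (l ⊕ v) K                        ≡⟨ primeProduct-cong {l ⊕ v} {legendre M (suc n)} K
                                                     (λ p _ → sym (∑-+ (λ m → multiples n (p ^ suc m))
                                                                       (λ m → 𝟙 (p ^ suc m ∣? suc n)) M)) ⟩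
  primeProduct (legendre M (suc n)) K           ∎
  where
  open ∣-Reasoning
  l = legendre M n
  v = valuation M (suc n)

-- Bhargava's factorial

exponent-extend : ∀ N p k .{{_ : NonTrivial p}} → ∑ (floorTerm N p) (k + suc N) ≡ exponent N p
exponent-extend N p k = ∑-vanishing (floorTerm N p) (suc N) k λ m N<m → floorTerm-large-m N p m N<m

-- Floors are superadditive. Since `exponent` takes the argument of the factorial minus one,
-- arguments `suc M` and `suc N` add up to index `M + suc N`; monotonicity absorbs the extra one.
exponent-superadditive : ∀ M N p .{{_ : NonTrivial p}} →
                         exponent M p + exponent N p ℕ.≤ exponent (M + suc N) p
exponent-superadditive M N p = begin
  exponent M p + exponent N p                 ≡⟨ cong₂ _+_ (extend M (suc N) (+-comm (suc N) (suc M)))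
                                                   (extend N (suc M) refl) ⟩
  ∑ (floorTerm M p) K + ∑ (floorTerm N p) K   ≡⟨ ∑-+ (floorTerm M p) (floorTerm N p) K ⟨
  ∑ (λ m → floorTerm M p m + floorTerm N p m) K
                                              ≤⟨ ∑-mono-≤ K termwise ⟩
  exponent (M + suc N) p                      ∎
  where
  open ≤-Reasoning
  K = suc (M + suc N)

  extend : ∀ A k → k + suc A ≡ K → exponent A p ≡ ∑ (floorTerm A p) K
  extend A k eq = trans (sym (exponent-extend A p k)) (cong (∑ (floorTerm A p)) eq)

  termwise : ∀ m → floorTerm M p m + floorTerm N p m ℕ.≤ floorTerm (M + suc N) p m
  termwise m = ≤-trans (+-/-≤ M N d) (/-monoˡ-≤ d (+-monoʳ-≤ M (n≤1+n N)))
    where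
    d = denominator p m
    instance
      d≢0 : NonZero d
      d≢0 = denominator-nonZero p m

-- Termwise, `p ^ m * (p ∸ 1)` is strictly less than `p ^ suc m`, and this strictness pays for the
-- drop from `suc N` to `N`.
legendre≤exponent : ∀ N → legendre (suc N) (suc N) ≤ₑ exponent N
legendre≤exponent N p = ∑-mono-≤ (suc N) termwise
  where
  instance
    p≢0 : NonZero p
    p≢0 = nonTrivial⇒nonZero p

  termwise : ∀ m → multiples (suc N) (p ^ suc m) ℕ.≤ floorTerm N p m
  termwise m = *≤⇒≤/ d {{denominator-nonZero p m}}
    (bound (multiples (suc N) (p ^ suc m))
      (multiples-*-≤ (suc N) (p ^ suc m) {{m^n≢0 p (suc m)}}))
    where
    d = denominator p m

    d<p^1+m : d < p ^ suc m
    d<p^1+m = subst (d <_) (*-comm (p ^ m) p)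
      (*-monoʳ-< (p ^ m) {{m^n≢0 p m}} (≤-reflexive (suc-pred p)))

    -- Strictness survives multiplication by `c` only if `c` is positive; for `c = 0` the claim is
    -- trivial.
    bound : ∀ c → c * p ^ suc m ℕ.≤ suc N → c * d ℕ.≤ N
    bound zero    _  = z≤n
    bound (suc c) c≤ = s≤s⁻¹ (<-≤-trans (*-monoʳ-< (suc c) d<p^1+m) c≤)

-- The slack `k` allows factorials of different arguments to be written over the same primes.
bhargava≡primeProduct : ∀ N k → bhargava (suc N) ≡ primeProduct (exponent N) (k + suc (suc N))
bhargava≡primeProduct N k = begin
  bhargava (suc N)                              ≡⟨ cong product (map-cong primeFactor≗ (upTo (suc (suc N)))) ⟩
  primeProduct (exponent N) (suc (suc N))       ≡⟨ primeProduct-vanishing {exponent N} (suc (suc N)) k large ⟨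
  primeProduct (exponent N) (k + suc (suc N))   ∎
  where
  open ≡-Reasoning

  primeFactor≗ : ∀ p → primeFactor N p ≡ primePower (exponent N) p
  primeFactor≗ p with prime? p
  ... | yes _ = refl
  ... | no  _ = refl

  large : ∀ p .{{_ : NonTrivial p}} → suc (suc N) ℕ.≤ p → exponent N p ≡ 0
  large p 1+N<p = ∑-zero (suc N) λ m → floorTerm-large-p N p m 1+N<p

bhargava-nonZero : ∀ n → NonZero (bhargava n)
bhargava-nonZero zero    = _
bhargava-nonZero (suc N) = subst NonZero (sym (bhargava≡primeProduct N 0))
  (primeProduct-nonZero (exponent N) (suc (suc N)))

bhargava-*-∣ : ∀ m n → bhargava m * bhargava n ∣ bhargava (m + n)
-- `bhargava 0` is a separate clause without an exponent family, so zero arguments are handled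
-- apart.
bhargava-*-∣ zero    n       = ∣-reflexive (*-identityˡ (bhargava n))
bhargava-*-∣ (suc M) zero    =
  ∣-reflexive (trans (*-identityʳ (bhargava (suc M))) (cong (bhargava ∘ suc) (sym (+-identityʳ M))))
bhargava-*-∣ (suc M) (suc N) = begin
  bhargava (suc M) * bhargava (suc N)
    ≡⟨ cong₂ _*_ (toBound M (suc N) (+-comm (suc N) (suc (suc M))))
                 (toBound N (suc M) (cong suc (+-suc M (suc N)))) ⟩
  primeProduct (exponent M) K * primeProduct (exponent N) K
    ≡⟨ primeProduct-⊕ (exponent M) (exponent N) K ⟨
  primeProduct (exponent M ⊕ exponent N) K
    ∣⟨ primeProduct-mono-∣ {exponent M ⊕ exponent N} {exponent (M + suc N)} K (exponent-superadditive M N) ⟩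
  primeProduct (exponent (M + suc N)) K
    ≡⟨ bhargava≡primeProduct (M + suc N) 0 ⟨
  bhargava (suc (M + suc N)) ∎
  where
  open ∣-Reasoning
  K = suc (suc (M + suc N))

  toBound : ∀ A k → k + suc (suc A) ≡ K → bhargava (suc A) ≡ primeProduct (exponent A) K
  toBound A k eq = trans (bhargava≡primeProduct A k) (cong (primeProduct (exponent A)) eq)

n!∣bhargava : ∀ n .{{_ : NonZero n}} → n ! ∣ bhargava n
n!∣bhargava (suc N) = begin
  suc N !                                 ∣⟨ n!∣primeProduct-legendre (suc N) ≤-refl ≤-refl ⟩
  primeProduct l (suc (suc N))            ∣⟨ primeProduct-mono-∣ {l} {exponent N} (suc (suc N)) (legendre≤exponent N) ⟩
  primeProduct (exponent N) (suc (suc N)) ≡⟨ bhargava≡primeProduct N 0 ⟨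
  bhargava (suc N)                        ∎
  where
  open ∣-Reasoning
  l = legendre (suc N) (suc N)

bhargava-isAbstractFactorial : IsAbstractFactorial bhargava
bhargava-isAbstractFactorial = record
  { positive = bhargava-nonZero
  ; f0≡1     = refl
  ; binomial = λ {n} {k} k≤n → subst (λ m → bhargava k * bhargava (n ∸ k) ∣ bhargava m)
                 (m+[n∸m]≡n k≤n) (bhargava-*-∣ k (n ∸ k))
  ; n!∣f     = n!∣bhargava
  }

-- The exponents of r (suc N).
jump : ℕ → Exponents
jump N p = ∑ (λ m → 𝟙 (denominator p m ∣? suc N)) (suc (suc N))

-- Each floor rises by one exactly when its divisor divides `suc N`. The sum for `N` has one summand
-- fewer and is first extended by a vanishing one.
exponent-suc : ∀ N p .{{_ : NonTrivial p}} → exponent (suc N) p ≡ exponent N p + jump N p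
exponent-suc N p = begin
  exponent (suc N) p                          ≡⟨ ∑-cong (suc (suc N)) (λ m →
                                                   suc-/ N (denominator p m) {{denominator-nonZero p m}}) ⟩
  ∑ (λ m → floorTerm N p m + 𝟙 (denominator p m ∣? suc N)) (suc (suc N))
                                              ≡⟨ ∑-+ (floorTerm N p) (λ m → 𝟙 (denominator p m ∣? suc N)) (suc (suc N)) ⟩
  ∑ (floorTerm N p) (suc (suc N)) + jump N p  ≡⟨ cong (_+ jump N p) (exponent-extend N p 1) ⟩
  exponent N p + jump N p                     ∎
  where open ≡-Reasoning

-- The integer value of `r k`; it is 1 at `k = 0` since the factorials of 0 and 1 are both 1.
bhargavaRatio : ℕ → ℕ
bhargavaRatio zero    = 1
bhargavaRatio (suc N) = primeProduct (jump N) (suc (suc (suc N)))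

bhargava-suc : ∀ k → bhargava (suc k) ≡ bhargavaRatio k * bhargava k
bhargava-suc zero    = refl
bhargava-suc (suc N) = begin
  bhargava (suc (suc N))                         ≡⟨ bhargava≡primeProduct (suc N) 0 ⟩
  primeProduct (exponent (suc N)) K              ≡⟨ primeProduct-cong {exponent (suc N)} {jump N ⊕ exponent N} K
                                                      (λ p _ → trans (exponent-suc N p) (+-comm (exponent N p) (jump N p))) ⟩
  primeProduct (jump N ⊕ exponent N) K           ≡⟨ primeProduct-⊕ (jump N) (exponent N) K ⟩
  primeProduct (jump N) K * primeProduct (exponent N) K
                                                 ≡⟨ cong (primeProduct (jump N) K *_) (bhargava≡primeProduct N 1) ⟨
  primeProduct (jump N) K * bhargava (suc N)     ∎
  where
  open ≡-Reasoning
  K = suc (suc (suc N))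

bhargavaRatio-nonZero : ∀ k → NonZero (bhargavaRatio k)
bhargavaRatio-nonZero zero    = _
bhargavaRatio-nonZero (suc N) = primeProduct-nonZero (jump N) (suc (suc (suc N)))

-- Parity of the ratios and the limit superior

jump-2 : ∀ N → jump N 2 ≡ suc (∑ (λ m → 𝟙 (denominator 2 (suc m) ∣? suc N)) (suc N))
jump-2 N = trans (∑-first (λ m → 𝟙 (denominator 2 m ∣? suc N)) (suc N))
  (cong (_+ ∑ (λ m → 𝟙 (denominator 2 (suc m) ∣? suc N)) (suc N)) (𝟙≡1 (1 ∣? suc N) (1∣ suc N)))

δ2≤jump : ∀ N → δ 2 ≤ₑ jump N
δ2≤jump N p with p ≟ 2
... | yes refl = subst (1 ℕ.≤_) (sym (jump-2 N)) (s≤s z≤n)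
... | no  _    = z≤n

even-or-suc-even : ∀ n → 2 ∣ n ⊎ 2 ∣ suc n
even-or-suc-even zero    = inj₁ (2 ∣0)
even-or-suc-even (suc n) with even-or-suc-even n
... | inj₁ 2∣n   = inj₂ (∣m∣n⇒∣m+n ∣-refl 2∣n)
... | inj₂ 2∣1+n = inj₁ 2∣1+n

oddPrime⇒2∣p∸1 : ∀ {p} → Prime p → p ≢ 2 → 2 ∣ p ∸ 1
oddPrime⇒2∣p∸1 {zero}  pr p≢2 = 2 ∣0
oddPrime⇒2∣p∸1 {suc p} pr p≢2 with even-or-suc-even p
... | inj₁ 2∣p   = 2∣p
-- An even prime is 2; the other outcome of irreducibility, `2 ≡ 1`, is absurd.
... | inj₂ 2∣1+p with prime⇒irreducible pr 2∣1+p
...   | inj₂ 2≡1+p = contradiction (sym 2≡1+p) p≢2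

-- An odd number has no even divisor. For `p = 2` only the divisor 1 at `m = 0` remains; for odd `p`
-- the factor `p ∸ 1` makes every divisor even.
jump≡δ2 : ∀ N → ¬ 2 ∣ suc N → ∀ p .{{_ : NonTrivial p}} → Prime p → jump N p ≡ δ 2 p
jump≡δ2 N odd p pr with p ≟ 2
... | yes refl = trans (jump-2 N) (cong suc (∑-zero (suc N) λ m →
  𝟙≡0 (denominator 2 (suc m) ∣? suc N) λ d∣1+N →
    odd (∣-trans (∣m⇒∣m*n 1 (m∣m*n (2 ^ m))) d∣1+N)))
... | no  p≢2  = ∑-zero (suc (suc N)) λ m →
  𝟙≡0 (denominator p m ∣? suc N) λ d∣1+N →
    odd (∣-trans (∣n⇒∣m*n (p ^ m) (oddPrime⇒2∣p∸1 pr p≢2)) d∣1+N)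

primeProduct-δ2 : ∀ N → primeProduct (δ 2) (suc (suc (suc N))) ≡ 2
primeProduct-δ2 N = primeProduct-δ {n = suc (suc (suc N))} prime[2] (s≤s (s≤s (s≤s z≤n)))

2≤bhargavaRatio : ∀ N → 2 ℕ.≤ bhargavaRatio (suc N)
2≤bhargavaRatio N = ∣⇒≤ {{bhargavaRatio-nonZero (suc N)}}
  (subst (_∣ bhargavaRatio (suc N)) (primeProduct-δ2 N)
    (primeProduct-mono-∣ {δ 2} {jump N} (suc (suc (suc N))) (δ2≤jump N)))

odd⇒bhargavaRatio≡2 : ∀ N → ¬ 2 ∣ suc N → bhargavaRatio (suc N) ≡ 2
odd⇒bhargavaRatio≡2 N odd = trans
  (primeProduct-cong {jump N} {δ 2} (suc (suc (suc N))) (jump≡δ2 N odd)) (primeProduct-δ2 N)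

odd-cofinal : ∀ n → ∃[ j ] ¬ 2 ∣ suc (n + j)
odd-cofinal n with 2 ∣? suc n
... | no  odd  = 0 , subst (λ m → ¬ 2 ∣ suc m) (sym (+-identityʳ n)) odd
-- If 2 divided two consecutive numbers, it would divide their difference 1.
... | yes even = 1 , λ 2∣ → contradiction (∣1⇒≡1 (∣m+n∣m⇒∣n {m = suc n} 2∣ even)) λ ()

1/r-bhargava : ∀ k → 1/r bhargava bhargava-isAbstractFactorial k ≡ 1/1+ (pred (bhargavaRatio k))
1/r-bhargava k = 1/r≡1/1+ bhargava bhargava-isAbstractFactorial k _
  (trans (bhargava-suc k)
    (cong (_* bhargava k) (sym (suc-pred (bhargavaRatio k) {{bhargavaRatio-nonZero k}}))))

limsup-bhargava : IsLimsup (1/r bhargava bhargava-isAbstractFactorial) ½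
limsup-bhargava = sups , isSup , min⇒IsInf 1 refl (λ { zero → 1/1+-anti-≤ z≤n ; (suc _) → ℚ.≤-refl })
  where
  sups : ℕ → ℚ
  -- The full sequence contains the term for `r 0 = 1`; from index 1 on all ratios are at least 2,
  -- with 2 attained in every tail.
  sups zero    = 1ℚ
  sups (suc _) = ½

  isSup : ∀ n → IsSup (λ j → 1/r bhargava bhargava-isAbstractFactorial (n + j)) (sups n)
  isSup zero    = tailSup _ (pred ∘ bhargavaRatio) 1/r-bhargava 0 0 0 refl (λ _ → z≤n)
  isSup (suc n) = let j , odd = odd-cofinal n in
    -- The minimum `1` is the ratio 2 in the offset encoding of `1/1+`.
    tailSup _ (pred ∘ bhargavaRatio) 1/r-bhargava (suc n) j 1
      (cong pred (odd⇒bhargavaRatio≡2 (n + j) odd))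
      (λ i → pred-mono-≤ (2≤bhargavaRatio (n + i)))

lemma10 : (ExcludedMiddle 0ℓ →
    ∀ (f : ℕ → ℕ) (isAF : IsAbstractFactorial f) →
    IsLimsup (1/r f isAF) 1ℚ ⊎ (∃[ L ] (IsLimsup (1/r f isAF) L × L ≤ ½)))
    × (Σ[ isAF ∈ IsAbstractFactorial bhargava ] IsLimsup (1/r bhargava isAF) ½)
lemma10 =
  (λ em f isAF → limsup-dichotomy (1/r f isAF) (proj₁ ∘ r-integral f isAF)
    (λ k → 1/r≡1/1+ f isAF k _ (proj₂ (r-integral f isAF k))) em)
  , bhargava-isAbstractFactorial , limsup-bhargava
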